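{- Let $q \ge 2$ and $n \ge 1$ be integers, and let $C \subseteq H_q^n$ be an equidistant code with distance $d$. Assume that $d \neq \frac{(q-1)n+1}{q}$. Then $$|C| \le n(q-1).$$
   Context: $H_q^n = \{0,1,\ldots,q-1\}^n$ is the $q$-ary Hamming space, with Hamming distance $\mathrm{d_H}(x,y) = |\{i \in \{1,\ldots,n\} : x(i) \neq y(i)\}|$, where $x(i)$ is the $i$-th coordinate of $x$. An equidistant code with distance $d$ is a set $C \subseteq H_q^n$ whose pairwise Hamming distances between distinct codewords take exactly one value, and this value is $d$ (so $|C|\ge 2$ and $d \ge 1$). -}

module Defs where

open import Data.Fin using (Fin; _≟_)
open import Data.List using (List; length; filter; allFin)
open import Data.List.Membership.Propositional using (_∈_)
open import Data.List.Relation.Unary.Unique.Propositional using (Unique)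
open import Data.Nat using (ℕ)
open import Data.Product using (∃₂; _×_)
open import Data.Vec using (Vec; lookup)
open import Relation.Binary.PropositionalEquality using (_≡_; _≢_)
open import Relation.Nullary.Decidable using (¬?)

H : ℕ → ℕ → Set
H q n = Vec (Fin q) n

dH : ∀ {q n} → H q n → H q n → ℕ
dH {n = n} x y = length (filter (λ i → ¬? (lookup x i ≟ lookup y i)) (allFin n))

-- A subset of the finite set H q n, given by a duplicate-free enumeration,
-- so that its cardinality is the length of the list.
record Code (q n : ℕ) : Set where
  field
    words  : List (H q n)
    unique : Unique words

open Code public

infix 4 _∈ᶜ_

_∈ᶜ_ : ∀ {q n} → H q n → Code q n → Set
x ∈ᶜ C = x ∈ words C

card : ∀ {q n} → Code q n → ℕ
card C = length (words C)

-- The distance set { dH x y ∣ x , y ∈ C , x ≠ y } is exactly { d }.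
record Equidistant {q n : ℕ} (C : Code q n) (d : ℕ) : Set where
  field
    attained : ∃₂ λ x y → x ∈ᶜ C × y ∈ᶜ C × x ≢ y × dH x y ≡ d
    only     : ∀ {x y} → x ∈ᶜ C → y ∈ᶜ C → x ≢ y → dH x y ≡ d

{-# OPTIONS --safe #-}

-- Take M = n(q-1) + 1 words of C.  Send a word x to the n × q array v_x
-- with entries q[xᵢ = a] - 1.  Every row of such an array has sum zero, so the
-- arrays span a space of dimension at most n(q-1) < M and satisfy a nontrivial
-- relation ∑ c_x v_x = 0.  Adding up its entries at the places (i, yᵢ) gives
-- (q(n - d) - n) ∑ c_x + q d c_y = 0.  As d ≠ 0, the sum ∑ c_x cannot vanish;
-- adding these equations over all y then forces q d = M.
module Submission where

open import Data.Nat using (ℕ; _+_; _*_; _∸_; _≤_; NonZero)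
open import Data.Integer using (+_)
open import Data.Rational using (_/_)
open import Relation.Binary.PropositionalEquality using (_≢_)
open import Defs

open import Data.Bool using (true; false; if_then_else_)
open import Data.Fin using (Fin; zero; suc; _≟_; combine; remQuot; inject≤; punchIn; punchOut)
open import Data.Fin.Properties
  using (any?; ¬∀⟶∃¬; punchIn-punchOut; remQuot-combine; inject≤-injective)
open import Data.Integer using (ℤ; 0ℤ; 1ℤ)
import Data.Integer as ℤ
import Data.Integer.Properties as ℤ
open import Data.Integer.Tactic.RingSolver using (solve-∀)
open import Data.List using (List; length; filter; tabulate)
import Data.List as List
open import Data.List.Membership.Propositional using (lose)
open import Data.List.Membership.Propositional.Properties using (∈-lookup; ∈-allFin)
open import Data.List.Properties using (filter-some)
open import Data.List.Relation.Unary.AllPairs using (_∷_)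
import Data.List.Relation.Unary.All as All
open import Data.List.Relation.Unary.Unique.Propositional using (Unique)
open import Data.Nat using (zero; suc; s≤s; z≤n)
import Data.Nat.Properties as ℕ
open import Data.Product using (∃; _×_; _,_; proj₁; proj₂)
open import Data.Rational.Properties using (fromℚᵘ-cong)
open import Data.Rational.Unnormalised using (mkℚᵘ; *≡*)
open import Data.Sum using ([_,_]′)
open import Data.Vec using (lookup)
open import Data.Vec.Properties using (tabulate∘lookup; tabulate-cong)
open import Function using (_∘_)
open import Relation.Binary.PropositionalEquality
  using (_≡_; refl; sym; trans; cong; cong₂; module ≡-Reasoning)
open import Relation.Nullary using (Dec; does; yes; no; contradiction)
open import Relation.Nullary.Decidable using (¬?)
open import Relation.Unary using (Decidable)

open import Algebra.Properties.Semiring.Sum ℤ.+-*-semiring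
  using (sum; sum-syntax; sum-cong-≗; sum-replicate-zero; ∑-distrib-+; ∑-comm;
         *-distribˡ-sum; *-distribʳ-sum)

open ≡-Reasoning

-- Indicators and finite sums of integers.

𝟙 : {P : Set} → Dec P → ℤ
𝟙 P? = if does P? then 1ℤ else 0ℤ

δ : ∀ {n} → Fin n → Fin n → ℤ
δ i j = 𝟙 (i ≟ j)

∑-zero : ∀ {n} {f : Fin n → ℤ} → (∀ i → f i ≡ 0ℤ) → sum f ≡ 0ℤ
∑-zero {n} f≡0 = trans (sum-cong-≗ f≡0) (sum-replicate-zero n)

∑-const : ∀ n x → ∑[ _ < n ] x ≡ + n ℤ.* x
∑-const zero    x = sym (ℤ.*-zeroˡ x)
∑-const (suc n) x = begin
  x ℤ.+ ∑[ _ < n ] x      ≡⟨ cong (ℤ._+_ x) (∑-const n x) ⟩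
  x ℤ.+ + n ℤ.* x         ≡⟨ ℤ.suc-* (+ n) x ⟨
  + suc n ℤ.* x           ∎

∑-δ : ∀ {n} (i : Fin n) (f : Fin n → ℤ) → ∑[ j < n ] (δ i j ℤ.* f j) ≡ f i
∑-δ {suc n} zero f = begin
  1ℤ ℤ.* f zero ℤ.+ ∑[ j < n ] (0ℤ ℤ.* f (suc j))
    ≡⟨ cong₂ ℤ._+_ (ℤ.*-identityˡ (f zero)) (∑-zero (ℤ.*-zeroˡ ∘ f ∘ suc)) ⟩
  f zero ℤ.+ 0ℤ
    ≡⟨ ℤ.+-identityʳ (f zero) ⟩
  f zero ∎
∑-δ {suc n} (suc i) f = begin
  0ℤ ℤ.* f zero ℤ.+ ∑[ j < n ] (δ i j ℤ.* f (suc j))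
    ≡⟨ cong₂ ℤ._+_ (ℤ.*-zeroˡ (f zero)) (∑-δ i (f ∘ suc)) ⟩
  0ℤ ℤ.+ f (suc i)
    ≡⟨ ℤ.+-identityˡ (f (suc i)) ⟩
  f (suc i) ∎

∑-linear : ∀ {n} a b (f g : Fin n → ℤ) →
  ∑[ i < n ] (a ℤ.* f i ℤ.+ b ℤ.* g i) ≡ a ℤ.* sum f ℤ.+ b ℤ.* sum g
∑-linear a b f g = trans (∑-distrib-+ (λ i → a ℤ.* f i) (λ i → b ℤ.* g i))
  (sym (cong₂ ℤ._+_ (*-distribˡ-sum a f) (*-distribˡ-sum b g)))

-- Each index is counted exactly once, on the left if `P` fails there and on the right if it holds.
-- A general `f` lets the induction pass to `f ∘ suc`; the identity gives `allFin n`.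
length-filter-¬ : ∀ {A : Set} {P : A → Set} (P? : Decidable P) {n} (f : Fin n → A) →
  + length (filter (¬? ∘ P?) (tabulate f)) ℤ.+ ∑[ i < n ] 𝟙 (P? (f i)) ≡ + n
length-filter-¬ P? {zero}  f = refl
length-filter-¬ P? {suc n} f with does (P? (f zero)) | length-filter-¬ P? (f ∘ suc)
... | true  | ih = trans (shift l s) (cong (ℤ._+_ 1ℤ) ih)
  where
  l s : ℤ
  l = + length (filter (¬? ∘ P?) (tabulate (f ∘ suc)))
  s = ∑[ i < n ] 𝟙 (P? (f (suc i)))
  shift : ∀ l s → l ℤ.+ (1ℤ ℤ.+ s) ≡ 1ℤ ℤ.+ (l ℤ.+ s)
  shift = solve-∀
... | false | ih = trans (shift l s) (cong (ℤ._+_ 1ℤ) ih)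
  where
  l s : ℤ
  l = + length (filter (¬? ∘ P?) (tabulate (f ∘ suc)))
  s = ∑[ i < n ] 𝟙 (P? (f (suc i)))
  shift : ∀ l s → (1ℤ ℤ.+ l) ℤ.+ (0ℤ ℤ.+ s) ≡ 1ℤ ℤ.+ (l ℤ.+ s)
  shift = solve-∀

-- Homogeneous linear systems over the integers.

-- Gaussian elimination without division, by induction on `m`. If the first column vanishes, the
-- first unit vector is a solution; otherwise a nonzero entry of it serves as pivot, and the first
-- unknown is eliminated by cross-multiplication.
linear-dependence : ∀ m (A : Fin m → Fin (suc m) → ℤ) →
  ∃ λ (c : Fin (suc m) → ℤ) →
    (∃ λ j → c j ≢ 0ℤ) × (∀ i → ∑[ j < suc m ] (A i j ℤ.* c j) ≡ 0ℤ)
linear-dependence zero    A = (λ _ → 1ℤ) , (zero , λ ()) , λ ()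
linear-dependence (suc m) A with any? (λ i → ¬? (A i zero ℤ.≟ 0ℤ))
... | no column≡0 = (λ j → δ zero j) , (zero , λ ()) , relation
  where
  relation : ∀ i → ∑[ j < suc (suc m) ] (A i j ℤ.* δ zero j) ≡ 0ℤ
  relation i with A i zero ℤ.≟ 0ℤ
  ... | no  Ai0≢0 = contradiction (i , Ai0≢0) column≡0
  ... | yes Ai0≡0 = begin
    ∑[ j < suc (suc m) ] (A i j ℤ.* δ zero j) ≡⟨ sum-cong-≗ (λ j → ℤ.*-comm (A i j) (δ zero j)) ⟩
    ∑[ j < suc (suc m) ] (δ zero j ℤ.* A i j) ≡⟨ ∑-δ zero (A i) ⟩
    A i zero                                ≡⟨ Ai0≡0 ⟩
    0ℤ                                      ∎
... | yes (r , Ar0≢0) = c , (suc k , ck≢0) , relation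
  where
  pivot : ℤ
  pivot = A r zero

  reduced : Fin (suc m) → Fin (suc m) → ℤ
  reduced i j = pivot ℤ.* A i (suc j) ℤ.- A i zero ℤ.* A r (suc j)

  -- Row `r` of `reduced` is zero. Leaving it out keeps `m` equations in `suc m` unknowns.
  IH = linear-dependence m (reduced ∘ punchIn r)
  c′ = proj₁ IH
  k  = proj₁ (proj₁ (proj₂ IH))

  tail-sum : Fin (suc m) → ℤ
  tail-sum i = ∑[ j < suc m ] (A i (suc j) ℤ.* c′ j)

  c : Fin (suc (suc m)) → ℤ
  -- Scaling the other unknowns by `pivot` makes equation `r` solvable for the first one in
  -- integers.
  c zero    = ℤ.- tail-sum r
  c (suc j) = pivot ℤ.* c′ j

  ck≢0 : c (suc k) ≢ 0ℤ
  ck≢0 eq = [ Ar0≢0 , proj₂ (proj₁ (proj₂ IH)) ]′ (ℤ.i*j≡0⇒i≡0∨j≡0 pivot eq)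

  -- `row-reduced` has the same right-hand side, so `c` satisfies equation `i` as soon as `c′`
  -- satisfies the reduced one.
  row : ∀ i → ∑[ j < suc (suc m) ] (A i j ℤ.* c j) ≡
              pivot ℤ.* tail-sum i ℤ.+ ℤ.- A i zero ℤ.* tail-sum r
  row i = begin
    A i zero ℤ.* ℤ.- tail-sum r ℤ.+ ∑[ j < suc m ] (A i (suc j) ℤ.* (pivot ℤ.* c′ j))
      ≡⟨ cong (ℤ._+_ (A i zero ℤ.* ℤ.- tail-sum r))
           (trans (sum-cong-≗ (λ j → swap (A i (suc j)) pivot (c′ j)))
                  (sym (*-distribˡ-sum pivot (λ j → A i (suc j) ℤ.* c′ j)))) ⟩
    A i zero ℤ.* ℤ.- tail-sum r ℤ.+ pivot ℤ.* tail-sum i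
      ≡⟨ reorder (A i zero) (tail-sum r) (pivot ℤ.* tail-sum i) ⟩
    pivot ℤ.* tail-sum i ℤ.+ ℤ.- A i zero ℤ.* tail-sum r ∎
    where
    swap : ∀ a p x → a ℤ.* (p ℤ.* x) ≡ p ℤ.* (a ℤ.* x)
    swap = solve-∀
    reorder : ∀ a s t → a ℤ.* ℤ.- s ℤ.+ t ≡ t ℤ.+ ℤ.- a ℤ.* s
    reorder = solve-∀

  row-reduced : ∀ i → ∑[ j < suc m ] (reduced i j ℤ.* c′ j) ≡
                      pivot ℤ.* tail-sum i ℤ.+ ℤ.- A i zero ℤ.* tail-sum r
  row-reduced i = trans
    (sum-cong-≗ (λ j → expand pivot (A i (suc j)) (A i zero) (A r (suc j)) (c′ j)))
    (∑-linear pivot (ℤ.- A i zero) (λ j → A i (suc j) ℤ.* c′ j) (λ j → A r (suc j) ℤ.* c′ j))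
    where
    expand : ∀ p x a y z →
      (p ℤ.* x ℤ.- a ℤ.* y) ℤ.* z ≡ p ℤ.* (x ℤ.* z) ℤ.+ ℤ.- a ℤ.* (y ℤ.* z)
    expand = solve-∀

  relation : ∀ i → ∑[ j < suc (suc m) ] (A i j ℤ.* c j) ≡ 0ℤ
  relation i with r ≟ i
  ... | yes refl = trans (row i) (cancel pivot (tail-sum r))
    where
    cancel : ∀ p s → p ℤ.* s ℤ.+ ℤ.- p ℤ.* s ≡ 0ℤ
    cancel = solve-∀
  ... | no  r≢i  = begin
    ∑[ j < suc (suc m) ] (A i j ℤ.* c j)
      ≡⟨ trans (row i) (sym (row-reduced i)) ⟩
    ∑[ j < suc m ] (reduced i j ℤ.* c′ j)
      ≡⟨ cong (λ i → ∑[ j < suc m ] (reduced i j ℤ.* c′ j)) (punchIn-punchOut r≢i) ⟨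
    ∑[ j < suc m ] (reduced (punchIn r (punchOut r≢i)) j ℤ.* c′ j)
      ≡⟨ proj₂ (proj₂ IH) (punchOut r≢i) ⟩
    0ℤ ∎

-- Agreements and Hamming distance.

agreements : ∀ {q n} → H q n → H q n → ℤ
agreements {n = n} x y = ∑[ i < n ] δ (lookup x i) (lookup y i)

dH+agreements : ∀ {q n} (x y : H q n) → + dH x y ℤ.+ agreements x y ≡ + n
dH+agreements x y = length-filter-¬ (λ i → lookup x i ≟ lookup y i) (λ i → i)

agreements-refl : ∀ {q n} (x : H q n) → agreements x x ≡ + n
agreements-refl {n = n} x =
  trans (sum-cong-≗ (δ-refl ∘ lookup x)) (trans (∑-const n 1ℤ) (ℤ.*-identityʳ (+ n)))
  where
  δ-refl : ∀ {q} (a : Fin q) → δ a a ≡ 1ℤ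
  δ-refl a with a ≟ a
  ... | yes _   = refl
  ... | no  a≢a = contradiction refl a≢a

-- Vectors with equal entries are equal, so by decidability some coordinate differs; that coordinate
-- survives the filter.
≢⇒dH≢0 : ∀ {q n} {x y : H q n} → x ≢ y → dH x y ≢ 0
≢⇒dH≢0 {n = n} {x} {y} x≢y dH≡0
  with ¬∀⟶∃¬ n (λ i → lookup x i ≡ lookup y i) (λ i → lookup x i ≟ lookup y i)
         (λ eq → x≢y (trans (sym (tabulate∘lookup x))
                       (trans (tabulate-cong eq) (tabulate∘lookup y))))
... | i , xi≢yi = ℕ.<⇒≢ (filter-some (λ i → ¬? (lookup x i ≟ lookup y i))
                           (lose (∈-allFin i) xi≢yi)) (sym dH≡0)

lookup-injective : ∀ {A : Set} {xs : List A} → Unique xs →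
  ∀ {i j} → List.lookup xs i ≡ List.lookup xs j → i ≡ j
lookup-injective (_ ∷ _)  {zero}  {zero}  _  = refl
lookup-injective (x ∷ _)  {zero}  {suc j} eq = contradiction eq (All.lookup x (∈-lookup j))
lookup-injective (x ∷ _)  {suc i} {zero}  eq = contradiction (sym eq) (All.lookup x (∈-lookup i))
lookup-injective (_ ∷ xs) {suc i} {suc j} eq = cong suc (lookup-injective xs eq)

-- Equidistant families of n(q-1) + 1 words, with q = p + 1.

module _ {p n d : ℕ} (w : Fin (suc (n * p)) → H (suc p) n)
         (equidistant : ∀ {j k} → j ≢ k → dH (w j) (w k) ≡ d)
         (d≢0 : d ≢ 0) where

  private
    M : ℕ
    M = suc (n * p)

    q E : ℤ
    q = + suc p
    E = q ℤ.* (+ n ℤ.- + d) ℤ.- + n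

    entry : Fin M → Fin n → Fin (suc p) → ℤ
    entry j i a = q ℤ.* δ (lookup (w j) i) a ℤ.- 1ℤ

    -- The symbol 0 is omitted: its column is determined by the others.
    matrix : Fin (n * p) → Fin M → ℤ
    matrix r j = entry j (proj₁ (remQuot {n} p r)) (suc (proj₂ (remQuot {n} p r)))

  module _ (c : Fin M → ℤ) (c≢0 : ∃ λ k → c k ≢ 0ℤ)
           (relation : ∀ r → ∑[ j < M ] (matrix r j ℤ.* c j) ≡ 0ℤ) where

    combination : Fin n → Fin (suc p) → ℤ
    combination i a = ∑[ j < M ] (entry j i a ℤ.* c j)

    combination-suc≡0 : ∀ i a → combination i (suc a) ≡ 0ℤ
    combination-suc≡0 i a = begin
      combination i (suc a)
        ≡⟨ cong (λ (i , a) → combination i (suc a)) (remQuot-combine {n} i a) ⟨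
      ∑[ j < M ] (matrix (combine i a) j ℤ.* c j)
        ≡⟨ relation (combine i a) ⟩
      0ℤ ∎

    -- True for any coefficients: in row `i` of each array one entry is q - 1 and the other p are
    -- -1.
    ∑-combination≡0 : ∀ i → ∑[ a < suc p ] combination i a ≡ 0ℤ
    ∑-combination≡0 i = trans (∑-comm (λ a j → entry j i a ℤ.* c j)) (∑-zero λ j → begin
      ∑[ a < suc p ] (entry j i a ℤ.* c j)
        ≡⟨ sum-cong-≗ (λ a → expand q (δ (lookup (w j) i) a) (c j)) ⟩
      ∑[ a < suc p ] (δ (lookup (w j) i) a ℤ.* (q ℤ.* c j) ℤ.+ ℤ.- c j)
        ≡⟨ ∑-distrib-+ (λ a → δ (lookup (w j) i) a ℤ.* (q ℤ.* c j)) (λ _ → ℤ.- c j) ⟩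
      ∑[ a < suc p ] (δ (lookup (w j) i) a ℤ.* (q ℤ.* c j)) ℤ.+ ∑[ _ < suc p ] (ℤ.- c j)
        ≡⟨ cong₂ ℤ._+_ (∑-δ (lookup (w j) i) (λ _ → q ℤ.* c j)) (∑-const (suc p) (ℤ.- c j)) ⟩
      q ℤ.* c j ℤ.+ q ℤ.* ℤ.- c j
        ≡⟨ cancel q (c j) ⟩
      0ℤ ∎)
      where
      expand : ∀ q t x → (q ℤ.* t ℤ.- 1ℤ) ℤ.* x ≡ t ℤ.* (q ℤ.* x) ℤ.+ ℤ.- x
      expand = solve-∀
      cancel : ∀ q x → q ℤ.* x ℤ.+ q ℤ.* ℤ.- x ≡ 0ℤ
      cancel = solve-∀

    combination≡0 : ∀ i a → combination i a ≡ 0ℤ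
    combination≡0 i (suc a) = combination-suc≡0 i a
    -- The row sum vanishes, and so do all its terms except this one.
    combination≡0 i zero    = begin
      combination i zero
        ≡⟨ ℤ.+-identityʳ _ ⟨
      combination i zero ℤ.+ 0ℤ
        ≡⟨ cong (ℤ._+_ (combination i zero)) (∑-zero (combination-suc≡0 i)) ⟨
      ∑[ a < suc p ] combination i a
        ≡⟨ ∑-combination≡0 i ⟩
      0ℤ ∎

    -- The arguments of `δ k j` are in this order so that `∑-δ k` can later collapse a sum over `j`.
    agreements-w : ∀ j k → agreements (w j) (w k) ≡ + n ℤ.- + d ℤ.+ + d ℤ.* δ k j
    agreements-w j k with k ≟ j
    ... | yes refl = trans (agreements-refl (w j)) (shift (+ n) (+ d))
      where
      shift : ∀ n d → n ≡ n ℤ.- d ℤ.+ d ℤ.* 1ℤ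
      shift = solve-∀
    ... | no k≢j = begin
      agreements (w j) (w k)
        ≡⟨ isolate (+ d) (agreements (w j) (w k)) ⟩
      (+ d ℤ.+ agreements (w j) (w k)) ℤ.- + d ℤ.+ + d ℤ.* 0ℤ
        ≡⟨ cong (λ e → (+ e ℤ.+ agreements (w j) (w k)) ℤ.- + d ℤ.+ + d ℤ.* 0ℤ)
             (equidistant (k≢j ∘ sym)) ⟨
      (+ dH (w j) (w k) ℤ.+ agreements (w j) (w k)) ℤ.- + d ℤ.+ + d ℤ.* 0ℤ
        ≡⟨ cong (λ e → e ℤ.- + d ℤ.+ + d ℤ.* 0ℤ) (dH+agreements (w j) (w k)) ⟩
      + n ℤ.- + d ℤ.+ + d ℤ.* 0ℤ ∎
      where
      isolate : ∀ d a → a ≡ (d ℤ.+ a) ℤ.- d ℤ.+ d ℤ.* 0ℤ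
      isolate = solve-∀

    -- Each agreement contributes q - 1 and each disagreement -1. Because the rows of the arrays
    -- have sum zero, this is the inner product of the two arrays divided by q.
    gram : ∀ j k → ∑[ i < n ] entry j i (lookup (w k) i) ≡ E ℤ.+ q ℤ.* + d ℤ.* δ k j
    gram j k = begin
      ∑[ i < n ] (q ℤ.* δ (lookup (w j) i) (lookup (w k) i) ℤ.- 1ℤ)
        ≡⟨ ∑-distrib-+ (λ i → q ℤ.* δ (lookup (w j) i) (lookup (w k) i)) (λ _ → ℤ.- 1ℤ) ⟩
      ∑[ i < n ] (q ℤ.* δ (lookup (w j) i) (lookup (w k) i)) ℤ.+ ∑[ _ < n ] (ℤ.- 1ℤ)
        ≡⟨ cong₂ ℤ._+_
             (sym (*-distribˡ-sum q (λ i → δ (lookup (w j) i) (lookup (w k) i))))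
             (∑-const n (ℤ.- 1ℤ)) ⟩
      q ℤ.* agreements (w j) (w k) ℤ.+ + n ℤ.* ℤ.- 1ℤ
        ≡⟨ cong (λ t → q ℤ.* t ℤ.+ + n ℤ.* ℤ.- 1ℤ) (agreements-w j k) ⟩
      q ℤ.* (+ n ℤ.- + d ℤ.+ + d ℤ.* δ k j) ℤ.+ + n ℤ.* ℤ.- 1ℤ
        ≡⟨ regroup q (+ n) (+ d) (δ k j) ⟩
      E ℤ.+ q ℤ.* + d ℤ.* δ k j ∎
      where
      regroup : ∀ q n d t → q ℤ.* (n ℤ.- d ℤ.+ d ℤ.* t) ℤ.+ n ℤ.* ℤ.- 1ℤ ≡
                            q ℤ.* (n ℤ.- d) ℤ.- n ℤ.+ q ℤ.* d ℤ.* t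
      regroup = solve-∀

    -- A double sum over words and coordinates, evaluated in two ways: summing over coordinates
    -- first gives `gram`, summing over words first gives entries of the vanishing combination.
    pairing : ∀ k → E ℤ.* sum c ℤ.+ q ℤ.* + d ℤ.* c k ≡ 0ℤ
    pairing k = begin
      E ℤ.* sum c ℤ.+ q ℤ.* + d ℤ.* c k
        ≡⟨ cong (λ t → E ℤ.* sum c ℤ.+ q ℤ.* + d ℤ.* t) (∑-δ k c) ⟨
      E ℤ.* sum c ℤ.+ q ℤ.* + d ℤ.* ∑[ j < M ] (δ k j ℤ.* c j)
        ≡⟨ ∑-linear E (q ℤ.* + d) c (λ j → δ k j ℤ.* c j) ⟨
      ∑[ j < M ] (E ℤ.* c j ℤ.+ q ℤ.* + d ℤ.* (δ k j ℤ.* c j))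
        ≡⟨ sum-cong-≗ (λ j → factor E (q ℤ.* + d) (δ k j) (c j)) ⟩
      ∑[ j < M ] ((E ℤ.+ q ℤ.* + d ℤ.* δ k j) ℤ.* c j)
        ≡⟨ sum-cong-≗ (λ j → cong (ℤ._* c j) (gram j k)) ⟨
      ∑[ j < M ] ((∑[ i < n ] entry j i (lookup (w k) i)) ℤ.* c j)
        ≡⟨ sum-cong-≗ (λ j → *-distribʳ-sum (c j) (λ i → entry j i (lookup (w k) i))) ⟩
      ∑[ j < M ] ∑[ i < n ] (entry j i (lookup (w k) i) ℤ.* c j)
        ≡⟨ ∑-comm (λ j i → entry j i (lookup (w k) i) ℤ.* c j) ⟩
      ∑[ i < n ] combination i (lookup (w k) i)
        ≡⟨ ∑-zero (λ i → combination≡0 i (lookup (w k) i)) ⟩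
      0ℤ ∎
      where
      factor : ∀ e f t x → e ℤ.* x ℤ.+ f ℤ.* (t ℤ.* x) ≡ (e ℤ.+ f ℤ.* t) ℤ.* x
      factor = solve-∀

    -- Otherwise `pairing` at a `k` with `c k` nonzero would read q d c_k = 0, a product of three
    -- nonzero integers.
    ∑c≢0 : sum c ≢ 0ℤ
    ∑c≢0 ∑c≡0 = [ [ (λ ()) , d≢0 ∘ ℤ.+-injective ]′ ∘ ℤ.i*j≡0⇒i≡0∨j≡0 q , proj₂ c≢0 ]′
      (ℤ.i*j≡0⇒i≡0∨j≡0 (q ℤ.* + d) (begin
        q ℤ.* + d ℤ.* c k                     ≡⟨ pad E (q ℤ.* + d ℤ.* c k) ⟩
        E ℤ.* 0ℤ ℤ.+ q ℤ.* + d ℤ.* c k        ≡⟨ cong (λ s → E ℤ.* s ℤ.+ q ℤ.* + d ℤ.* c k) ∑c≡0 ⟨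
        E ℤ.* sum c ℤ.+ q ℤ.* + d ℤ.* c k     ≡⟨ pairing k ⟩
        0ℤ                                    ∎))
      where
      k : Fin M
      k = proj₁ c≢0
      pad : ∀ e x → x ≡ e ℤ.* 0ℤ ℤ.+ x
      pad = solve-∀

    summed : (+ M ℤ.* E ℤ.+ q ℤ.* + d) ℤ.* sum c ≡ 0ℤ
    summed = begin
      (+ M ℤ.* E ℤ.+ q ℤ.* + d) ℤ.* sum c
        ≡⟨ expand (+ M) E (q ℤ.* + d) (sum c) ⟩
      E ℤ.* (+ M ℤ.* sum c) ℤ.+ q ℤ.* + d ℤ.* sum c
        ≡⟨ cong (λ t → E ℤ.* t ℤ.+ q ℤ.* + d ℤ.* sum c) (∑-const M (sum c)) ⟨
      E ℤ.* ∑[ _ < M ] sum c ℤ.+ q ℤ.* + d ℤ.* sum c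
        ≡⟨ ∑-linear E (q ℤ.* + d) (λ _ → sum c) c ⟨
      ∑[ k < M ] (E ℤ.* sum c ℤ.+ q ℤ.* + d ℤ.* c k)
        ≡⟨ ∑-zero pairing ⟩
      0ℤ ∎
      where
      expand : ∀ m e f s → (m ℤ.* e ℤ.+ f) ℤ.* s ≡ e ℤ.* (m ℤ.* s) ℤ.+ f ℤ.* s
      expand = solve-∀

    coefficient≡0 : + M ℤ.* E ℤ.+ q ℤ.* + d ≡ 0ℤ
    coefficient≡0 = [ (λ eq → eq) , (λ ∑c≡0 → contradiction ∑c≡0 ∑c≢0) ]′
      (ℤ.i*j≡0⇒i≡0∨j≡0 (+ M ℤ.* E ℤ.+ q ℤ.* + d) summed)

  -- Since `E` equals np - qd and `M` is np + 1, the coefficient M E + qd factors as np (M - qd),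
  -- and np can be cancelled.
  equidistant-simplex : n * p ≢ 0 → + d ℤ.* q ≡ + M
  equidistant-simplex np≢0 =
    [ (λ np≡0 → contradiction (ℤ.+-injective np≡0) np≢0) , sym ∘ ℤ.i-j≡0⇒i≡j (+ M) (+ d ℤ.* q) ]′
      (ℤ.i*j≡0⇒i≡0∨j≡0 (+ (n * p)) (begin
        + (n * p) ℤ.* (+ M ℤ.- + d ℤ.* q)
          ≡⟨ cong (λ t → t ℤ.* (1ℤ ℤ.+ t ℤ.- + d ℤ.* q)) (ℤ.pos-* n p) ⟩
        + n ℤ.* + p ℤ.* (1ℤ ℤ.+ + n ℤ.* + p ℤ.- + d ℤ.* q)
          ≡⟨ factor (+ n) (+ p) (+ d) ⟩
        (1ℤ ℤ.+ + n ℤ.* + p) ℤ.* E ℤ.+ q ℤ.* + d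
          ≡⟨ cong (λ t → (1ℤ ℤ.+ t) ℤ.* E ℤ.+ q ℤ.* + d) (ℤ.pos-* n p) ⟨
        + M ℤ.* E ℤ.+ q ℤ.* + d
          ≡⟨ (let c , c≢0 , relation = linear-dependence (n * p) matrix in coefficient≡0 c c≢0 relation) ⟩
        0ℤ ∎))
    where
    factor : ∀ n p d → n ℤ.* p ℤ.* (1ℤ ℤ.+ n ℤ.* p ℤ.- d ℤ.* (1ℤ ℤ.+ p)) ≡
      (1ℤ ℤ.+ n ℤ.* p) ℤ.* ((1ℤ ℤ.+ p) ℤ.* (n ℤ.- d) ℤ.- n) ℤ.+ (1ℤ ℤ.+ p) ℤ.* d
    factor = solve-∀

-- The bound on the code.

theorem6 : (q n : ℕ) → .{{_ : NonZero q}} → 2 ≤ q → 1 ≤ n →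
    (C : Code q n) (d : ℕ) → Equidistant C d →
    (+ d) / 1 ≢ (+ ((q ∸ 1) * n + 1)) / q →
    card C ≤ n * (q ∸ 1)
theorem6 (suc (suc p)) (suc n) (s≤s (s≤s z≤n)) (s≤s z≤n) C d C-equidistant d≢ = ℕ.≮⇒≥ λ large →
  let
    -- `large` says that the code has at least n(q-1) + 1 words; the first that many are taken.
    index : Fin (suc (suc n * suc p)) → Fin (card C)
    index j = inject≤ j large

    dq≡M : + d ℤ.* + suc (suc p) ≡ + suc (suc n * suc p)
    dq≡M = equidistant-simplex (List.lookup (words C) ∘ index)
      (λ {j} {k} j≢k → only (∈-lookup (index j)) (∈-lookup (index k))
        (j≢k ∘ inject≤-injective large large j k ∘ lookup-injective (unique C)))
      -- With n ≥ 1 and q ≥ 2 the product n(q-1) is visibly a successor.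
      d≢0 (λ ())
  -- Equality of the fractions reduces to cross-multiplication. `mkℚᵘ` stores the denominator minus
  -- one, so `0` and `suc p` stand for 1 and q.
  in d≢ (fromℚᵘ-cong {mkℚᵘ (+ d) 0} {mkℚᵘ (+ (suc p * suc n + 1)) (suc p)} (*≡* (begin
    + d ℤ.* + suc (suc p)          ≡⟨ dq≡M ⟩
    + suc (suc n * suc p)          ≡⟨ cong (λ t → + suc t) (ℕ.*-comm (suc n) (suc p)) ⟩
    + suc (suc p * suc n)          ≡⟨ cong +_ (ℕ.+-comm 1 (suc p * suc n)) ⟩
    + (suc p * suc n + 1)          ≡⟨ ℤ.*-identityʳ _ ⟨
    + (suc p * suc n + 1) ℤ.* 1ℤ   ∎)))
  where
  open Equidistant C-equidistant

  d≢0 : d ≢ 0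
  d≢0 d≡0 with attained
  ... | _ , _ , _ , _ , x≢y , dH≡d = ≢⇒dH≢0 x≢y (trans dH≡d d≡0)
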